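{- Let $f:\mathbb{R}^n\to\mathbb{R}^m$ be a neural network, $x_0\in\mathbb{R}^n$ a reference input, $\|\cdot\|$ a norm on $\mathbb{R}^n$, and $\mathcal{P}(x_0,x)$ an output predicate. Let $q_i$ and $q_j$ be two robustness verification queries over $f$, $x_0$ and $\mathcal{P}$, with perturbation radii $\varepsilon_i>\varepsilon_j$, respectively. Then $q_j$ is a refinement of $q_i$, denoted $q_j\preceq q_i$.
   Context: **Verification queries.** A verification query $q$ for a network $f:\mathbb{R}^n\to\mathbb{R}^m$ is a pair $(\mathcal{X}(q),\mathcal{Y}(q))$ with $\mathcal{X}(q)\subseteq\mathbb{R}^n$ and $\mathcal{Y}(q)\subseteq\mathbb{R}^m$; it asks whether there is $x\in\mathcal{X}(q)$ with $f(x)\in\mathcal{Y}(q)$. **Refinement.** $q_2$ is a refinement of $q_1$, written $q_2\preceq q_1$, if both queries are defined over the same network $f$ and $\mathcal{X}(q_2)\subseteq\mathcal{X}(q_1)$ and $\mathcal{Y}(q_2)\subseteq\mathcal{Y}(q_1)$. **Robustness verification queries.** Fix a network $f$, a reference input $x_0$, a norm $\|\cdot\|$ (an $\ell_p$ norm), and a predicate $\mathcal{P}(x_0,x)$ expressing output inconsistency at $x$ relative to $x_0$ (e.g. misclassification). The predicate is a condition on the output $f(x)$ and is represented by an output region $\mathcal{Y}_{\mathcal{P}}\subseteq\mathbb{R}^m$, depending only on $f$, $x_0$ and $\mathcal{P}$, with $\mathcal{P}(x_0,x)$ holding iff $f(x)\in\mathcal{Y}_{\mathcal{P}}$. The robustness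 verification query with perturbation radius $\varepsilon\ge 0$ asks whether there exists $x\in\mathbb{R}^n$ with $\|x-x_0\|\le\varepsilon$ and $\mathcal{P}(x_0,x)$; that is, it is the query with input region $\{x\in\mathbb{R}^n : \|x-x_0\|\le\varepsilon\}$ and output region $\mathcal{Y}_{\mathcal{P}}$. -}

module Defs where

open import Data.Nat.Base as ℕ using (ℕ)
import Data.Nat.Properties as ℕ
open import Data.Product using (∃; _×_; _,_)
open import Data.Rational.Base as ℚ using (ℚ; 0ℚ; 1ℚ; ½)
import Data.Rational.Properties as ℚ
open import Data.Rational.Solver using (module +-*-Solver)
open import Data.Sum.Base using (inj₁; inj₂)
open import Data.Vec.Functional as Vector using (Vector)
import Data.Vec.Functional.Relation.Binary.Equality.Setoid as VectorEquality
open import Function.Bundles using (Func; _⟨$⟩_; _⇔_)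
import Function.Relation.Binary.Setoid.Equality as FuncEquality
open import Level using (0ℓ)
open import Relation.Binary.Bundles using (Setoid)
open import Relation.Binary.Definitions using (_Respects_)
open import Relation.Binary.PropositionalEquality
  using (_≡_; refl; sym; cong; cong₂; subst)
open import Relation.Unary using (Pred; _⊆_)

module _ where
  open import Data.Rational.Base using (_+_; _*_; _-_; -_; 1/_; ∣_∣; _≤_; _<_; positive; nonNegative)
  open ℚ.≤-Reasoning

  half+half : ∀ ε → ½ * ε + ½ * ε ≡ ε
  half+half = solve 1 (λ e → con ½ :* e :+ con ½ :* e := e) refl
    where open +-*-Solver

  half-pos : ∀ {ε} → 0ℚ < ε → 0ℚ < ½ * ε
  half-pos {ε} 0<ε = ℚ.positive⁻¹ (½ * ε) {{ℚ.pos*pos⇒pos ½ ε {{positive 0<ε}}}}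

  ∣p-p∣≤ : ∀ p {ε} → 0ℚ < ε → ∣ p - p ∣ ≤ ε
  ∣p-p∣≤ p {ε} 0<ε = subst (λ d → ∣ d ∣ ≤ ε) (sym (ℚ.+-inverseʳ p)) (ℚ.<⇒≤ 0<ε)

  ∣p-q∣≡∣q-p∣ : ∀ p q → ∣ p - q ∣ ≡ ∣ q - p ∣
  ∣p-q∣≡∣q-p∣ p q = begin-equality
    ∣ p - q ∣      ≡⟨ cong ∣_∣ (solve 2 (λ p q → p :- q := :- (q :- p)) refl p q) ⟩
    ∣ - (q - p) ∣  ≡⟨ ℚ.∣-p∣≡∣p∣ (q - p) ⟩
    ∣ q - p ∣      ∎
    where open +-*-Solver

  p≤∣p∣ : ∀ p → p ≤ ∣ p ∣
  p≤∣p∣ p with ℚ.≤-total 0ℚ p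
  ... | inj₁ 0≤p = ℚ.≤-reflexive (sym (ℚ.0≤p⇒∣p∣≡p 0≤p))
  ... | inj₂ p≤0 = ℚ.≤-trans p≤0 (ℚ.0≤∣p∣ p)

  ∣p-q∣≤δ⇒p≤q+δ : ∀ p q {δ} → ∣ p - q ∣ ≤ δ → p ≤ q + δ
  ∣p-q∣≤δ⇒p≤q+δ p q {δ} h = begin
    p            ≡⟨ solve 2 (λ p q → p := q :+ (p :- q)) refl p q ⟩
    q + (p - q)  ≤⟨ ℚ.+-monoʳ-≤ q (ℚ.≤-trans (p≤∣p∣ (p - q)) h) ⟩
    q + δ        ∎
    where open +-*-Solver

  triangle-halves : ∀ p q r {ε} → ∣ p - q ∣ ≤ ½ * ε → ∣ q - r ∣ ≤ ½ * ε → ∣ p - r ∣ ≤ ε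
  triangle-halves p q r {ε} h k = begin
    ∣ p - r ∣              ≡⟨ cong ∣_∣ (solve 3 (λ p q r → p :- r := (p :- q) :+ (q :- r)) refl p q r) ⟩
    ∣ (p - q) + (q - r) ∣  ≤⟨ ℚ.∣p+q∣≤∣p∣+∣q∣ (p - q) (q - r) ⟩
    ∣ p - q ∣ + ∣ q - r ∣  ≤⟨ ℚ.+-mono-≤ h k ⟩
    ½ * ε + ½ * ε          ≡⟨ half+half ε ⟩
    ε                      ∎
    where open +-*-Solver

  +-halves : ∀ p p′ q q′ {ε} → ∣ p - p′ ∣ ≤ ½ * ε → ∣ q - q′ ∣ ≤ ½ * ε →
             ∣ (p + q) - (p′ + q′) ∣ ≤ ε
  +-halves p p′ q q′ {ε} h k = begin
    ∣ (p + q) - (p′ + q′) ∣    ≡⟨ cong ∣_∣ (solve 4 (λ p p′ q q′ →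
                                    (p :+ q) :- (p′ :+ q′) := (p :- p′) :+ (q :- q′)) refl p p′ q q′) ⟩
    ∣ (p - p′) + (q - q′) ∣    ≤⟨ ℚ.∣p+q∣≤∣p∣+∣q∣ (p - p′) (q - q′) ⟩
    ∣ p - p′ ∣ + ∣ q - q′ ∣    ≤⟨ ℚ.+-mono-≤ h k ⟩
    ½ * ε + ½ * ε              ≡⟨ half+half ε ⟩
    ε                          ∎
    where open +-*-Solver

  neg-distance : ∀ p q → ∣ (- p) - (- q) ∣ ≡ ∣ p - q ∣
  neg-distance p q = begin-equality
    ∣ (- p) - (- q) ∣  ≡⟨ cong ∣_∣ (solve 2 (λ p q → (:- p) :- (:- q) := :- (p :- q)) refl p q) ⟩
    ∣ - (p - q) ∣      ≡⟨ ℚ.∣-p∣≡∣p∣ (p - q) ⟩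
    ∣ p - q ∣          ∎
    where open +-*-Solver

  ∣p∣-∣q∣≤∣p-q∣ : ∀ p q → ∣ p ∣ - ∣ q ∣ ≤ ∣ p - q ∣
  ∣p∣-∣q∣≤∣p-q∣ p q = begin
    ∣ p ∣ - ∣ q ∣                  ≡⟨ cong (λ r → ∣ r ∣ - ∣ q ∣) (solve 2 (λ p q → p := (p :- q) :+ q) refl p q) ⟩
    ∣ (p - q) + q ∣ - ∣ q ∣        ≤⟨ ℚ.+-monoˡ-≤ (- ∣ q ∣) (ℚ.∣p+q∣≤∣p∣+∣q∣ (p - q) q) ⟩
    (∣ p - q ∣ + ∣ q ∣) - ∣ q ∣    ≡⟨ solve 2 (λ a b → (a :+ b) :- b := a) refl ∣ p - q ∣ ∣ q ∣ ⟩
    ∣ p - q ∣                      ∎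
    where open +-*-Solver

  abs-distance : ∀ p q → ∣ ∣ p ∣ - ∣ q ∣ ∣ ≤ ∣ p - q ∣
  abs-distance p q with ℚ.∣p∣≡p∨∣p∣≡-p (∣ p ∣ - ∣ q ∣)
  ... | inj₁ eq = subst (_≤ ∣ p - q ∣) (sym eq) (∣p∣-∣q∣≤∣p-q∣ p q)
  ... | inj₂ eq = begin
    ∣ ∣ p ∣ - ∣ q ∣ ∣    ≡⟨ eq ⟩
    - (∣ p ∣ - ∣ q ∣)    ≡⟨ solve 2 (λ a b → :- (a :- b) := b :- a) refl ∣ p ∣ ∣ q ∣ ⟩
    ∣ q ∣ - ∣ p ∣        ≤⟨ ∣p∣-∣q∣≤∣p-q∣ q p ⟩
    ∣ q - p ∣            ≡⟨ ∣p-q∣≡∣q-p∣ q p ⟩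
    ∣ p - q ∣            ∎
    where open +-*-Solver

  *-distance : ∀ p p′ q q′ {B C δ} → 0ℚ < B → 0ℚ < C →
               ∣ p ∣ ≤ B → ∣ q′ ∣ ≤ C →
               ∣ p - p′ ∣ ≤ δ → ∣ q - q′ ∣ ≤ δ →
               ∣ p * q - p′ * q′ ∣ ≤ (B + C) * δ
  *-distance p p′ q q′ {B} {C} {δ} 0<B 0<C p≤B q′≤C h k = begin
    ∣ p * q - p′ * q′ ∣                      ≡⟨ cong ∣_∣ (solve 4 (λ p p′ q q′ →
                                                 p :* q :- p′ :* q′ := p :* (q :- q′) :+ q′ :* (p :- p′)) refl p p′ q q′) ⟩
    ∣ p * (q - q′) + q′ * (p - p′) ∣         ≤⟨ ℚ.∣p+q∣≤∣p∣+∣q∣ (p * (q - q′)) (q′ * (p - p′)) ⟩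
    ∣ p * (q - q′) ∣ + ∣ q′ * (p - p′) ∣     ≡⟨ cong₂ _+_ (ℚ.∣p*q∣≡∣p∣*∣q∣ p (q - q′)) (ℚ.∣p*q∣≡∣p∣*∣q∣ q′ (p - p′)) ⟩
    ∣ p ∣ * ∣ q - q′ ∣ + ∣ q′ ∣ * ∣ p - p′ ∣ ≤⟨ ℚ.+-mono-≤ (bound p≤B 0<B k) (bound q′≤C 0<C h) ⟩
    B * δ + C * δ                            ≡⟨ ℚ.*-distribʳ-+ δ B C ⟨
    (B + C) * δ                              ∎
    where
    open +-*-Solver
    bound : ∀ {a b D} → ∣ a ∣ ≤ D → 0ℚ < D → ∣ b ∣ ≤ δ → ∣ a ∣ * ∣ b ∣ ≤ D * δ
    bound {a} {b} {D} a≤D 0<D b≤δ = ℚ.≤-trans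
      (ℚ.*-monoʳ-≤-nonNeg ∣ b ∣ {{nonNegative (ℚ.0≤∣p∣ b)}} a≤D)
      (ℚ.*-monoˡ-≤-nonNeg D {{nonNegative (ℚ.<⇒≤ 0<D)}} b≤δ)

  divide : ∀ {S ε} → 0ℚ < S → 0ℚ < ε → ∃ λ δ → 0ℚ < δ × S * δ ≡ ε
  divide {S} {ε} 0<S 0<ε = (1/ S) * ε , 0<δ , Sδ≡ε
    where
    instance
      S-pos : ℚ.Positive S
      S-pos = positive 0<S
      S-nonZero : ℚ.NonZero S
      S-nonZero = ℚ.pos⇒nonZero S
    0<δ : 0ℚ < (1/ S) * ε
    0<δ = ℚ.positive⁻¹ ((1/ S) * ε) {{ℚ.pos*pos⇒pos (1/ S) {{ℚ.1/pos⇒pos S}} ε {{positive 0<ε}}}}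
    Sδ≡ε : S * ((1/ S) * ε) ≡ ε
    Sδ≡ε = begin-equality
      S * ((1/ S) * ε)  ≡⟨ ℚ.*-assoc S (1/ S) ε ⟨
      (S * (1/ S)) * ε  ≡⟨ cong (_* ε) (ℚ.*-inverseʳ S) ⟩
      1ℚ * ε            ≡⟨ ℚ.*-identityˡ ε ⟩
      ε                 ∎

Eventually : Pred ℕ 0ℓ → Set
Eventually P = ∃ λ N → ∀ n → N ℕ.≤ n → P n

eventually₂ : ∀ {P Q R : Pred ℕ 0ℓ} → (∀ n → P n → Q n → R n) →
              Eventually P → Eventually Q → Eventually R
eventually₂ f (M , p) (N , q) =
  M ℕ.⊔ N , λ n le → f n (p n (ℕ.m⊔n≤o⇒m≤o M N le)) (q n (ℕ.m⊔n≤o⇒n≤o M N le))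

eventually₁ : ∀ {P Q : Pred ℕ 0ℓ} → (∀ n → P n → Q n) → Eventually P → Eventually Q
eventually₁ f (N , p) = N , λ n le → f n (p n le)

EventuallyClose : (ℕ → ℚ) → ℚ → Set
EventuallyClose s ε =
  ∃ λ N → ∀ m n → N ℕ.≤ m → N ℕ.≤ n → ℚ.∣ s m ℚ.- s n ∣ ℚ.≤ ε

IsCauchy : (ℕ → ℚ) → Set
IsCauchy s = ∀ ε → 0ℚ ℚ.< ε → EventuallyClose s ε

-- The Cauchy completion of ℚ. Distinct sequences may represent the same real,
-- so equality of reals is _≃_ below, and subsets and functions must respect it.
record ℝ : Set where
  field
    seq    : ℕ → ℚ
    cauchy : IsCauchy seq

open ℝ public

infix 4 _≃_ _≤_ _<_ _>_

_≃_ : ℝ → ℝ → Set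
x ≃ y = ∀ ε → 0ℚ ℚ.< ε → Eventually λ n → ℚ.∣ seq x n ℚ.- seq y n ∣ ℚ.≤ ε

_≤_ : ℝ → ℝ → Set
x ≤ y = ∀ ε → 0ℚ ℚ.< ε → Eventually λ n → seq x n ℚ.≤ seq y n ℚ.+ ε

_<_ : ℝ → ℝ → Set
x < y = ∃ λ ε → 0ℚ ℚ.< ε × Eventually λ n → seq x n ℚ.+ ε ℚ.≤ seq y n

_>_ : ℝ → ℝ → Set
x > y = y < x

≃-refl : ∀ {x} → x ≃ x
≃-refl {x} ε 0<ε = 0 , λ n _ → ∣p-p∣≤ (seq x n) 0<ε

≃-sym : ∀ {x y} → x ≃ y → y ≃ x
≃-sym {x} {y} x≃y ε 0<ε =
  eventually₁ (λ n → subst (ℚ._≤ ε) (∣p-q∣≡∣q-p∣ (seq x n) (seq y n))) (x≃y ε 0<ε)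

≃-trans : ∀ {x y z} → x ≃ y → y ≃ z → x ≃ z
≃-trans {x} {y} {z} x≃y y≃z ε 0<ε =
  eventually₂ (λ n → triangle-halves (seq x n) (seq y n) (seq z n))
    (x≃y _ (half-pos 0<ε)) (y≃z _ (half-pos 0<ε))

ℝ-setoid : Setoid 0ℓ 0ℓ
ℝ-setoid = record
  { Carrier       = ℝ
  ; _≈_           = _≃_
  ; isEquivalence = record
    { refl  = λ {x} → ≃-refl {x}
    ; sym   = λ {x} {y} → ≃-sym {x} {y}
    ; trans = λ {x} {y} {z} → ≃-trans {x} {y} {z}
    }
  }

≤-respˡ-≃ : ∀ {x y z} → x ≃ y → x ≤ z → y ≤ z
≤-respˡ-≃ {x} {y} {z} x≃y x≤z ε 0<ε =
  eventually₂ step (x≃y _ (half-pos 0<ε)) (x≤z _ (half-pos 0<ε))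
  where
  open ℚ.≤-Reasoning
  δ = ½ ℚ.* ε
  step : ∀ n → ℚ.∣ seq x n ℚ.- seq y n ∣ ℚ.≤ δ → seq x n ℚ.≤ seq z n ℚ.+ δ →
         seq y n ℚ.≤ seq z n ℚ.+ ε
  step n h k = begin
    seq y n                    ≤⟨ ∣p-q∣≤δ⇒p≤q+δ (seq y n) (seq x n)
                                    (subst (ℚ._≤ δ) (∣p-q∣≡∣q-p∣ (seq x n) (seq y n)) h) ⟩
    seq x n ℚ.+ δ              ≤⟨ ℚ.+-monoˡ-≤ δ k ⟩
    (seq z n ℚ.+ δ) ℚ.+ δ      ≡⟨ ℚ.+-assoc (seq z n) δ δ ⟩
    seq z n ℚ.+ (δ ℚ.+ δ)      ≡⟨ cong (seq z n ℚ.+_) (half+half ε) ⟩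
    seq z n ℚ.+ ε              ∎

infix  8 -_
infixl 7 _*_
infixl 6 _+_ _-_

0ℝ : ℝ
0ℝ = record { seq = λ _ → 0ℚ ; cauchy = λ ε 0<ε → 0 , λ _ _ _ _ → ∣p-p∣≤ 0ℚ 0<ε }

_+_ : ℝ → ℝ → ℝ
x + y = record
  { seq    = λ n → seq x n ℚ.+ seq y n
  ; cauchy = λ ε 0<ε →
      let M , p = cauchy x _ (half-pos 0<ε)
          N , q = cauchy y _ (half-pos 0<ε)
      in M ℕ.⊔ N , λ m n lm ln → +-halves (seq x m) (seq x n) (seq y m) (seq y n)
           (p m n (ℕ.m⊔n≤o⇒m≤o M N lm) (ℕ.m⊔n≤o⇒m≤o M N ln))
           (q m n (ℕ.m⊔n≤o⇒n≤o M N lm) (ℕ.m⊔n≤o⇒n≤o M N ln))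
  }

-_ : ℝ → ℝ
- x = record
  { seq    = λ n → ℚ.- seq x n
  ; cauchy = λ ε 0<ε →
      let N , p = cauchy x ε 0<ε
      in N , λ m n lm ln →
           subst (ℚ._≤ ε) (sym (neg-distance (seq x m) (seq x n))) (p m n lm ln)
  }

_-_ : ℝ → ℝ → ℝ
x - y = x + (- y)

∣_∣ : ℝ → ℝ
∣ x ∣ = record
  { seq    = λ n → ℚ.∣ seq x n ∣
  ; cauchy = λ ε 0<ε →
      let N , p = cauchy x ε 0<ε
      in N , λ m n lm ln → ℚ.≤-trans (abs-distance (seq x m) (seq x n)) (p m n lm ln)
  }

eventually-bounded : ∀ x → ∃ λ B → 0ℚ ℚ.< B × Eventually λ n → ℚ.∣ seq x n ∣ ℚ.≤ B
eventually-bounded x =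
  let N , p = cauchy x 1ℚ (ℚ.positive⁻¹ 1ℚ)
      b     = ℚ.∣ seq x N ∣
  in b ℚ.+ 1ℚ
   , ℚ.+-mono-≤-< (ℚ.0≤∣p∣ (seq x N)) (ℚ.positive⁻¹ 1ℚ)
   , N , λ n le → ∣p-q∣≤δ⇒p≤q+δ ℚ.∣ seq x n ∣ b
       (ℚ.≤-trans (abs-distance (seq x n) (seq x N)) (p n N le ℕ.≤-refl))

*-cauchy : ∀ x y → IsCauchy (λ n → seq x n ℚ.* seq y n)
*-cauchy x y ε 0<ε =
  let B , 0<B , xB        = eventually-bounded x
      C , 0<C , yC        = eventually-bounded y
      δ , 0<δ , [B+C]δ≡ε  = divide {B ℚ.+ C} {ε} (ℚ.+-mono-< 0<B 0<C) 0<ε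
  in combine B C δ 0<B 0<C [B+C]δ≡ε xB yC (cauchy x δ 0<δ) (cauchy y δ 0<δ)
  where
  combine : ∀ B C δ → 0ℚ ℚ.< B → 0ℚ ℚ.< C → (B ℚ.+ C) ℚ.* δ ≡ ε →
            Eventually (λ n → ℚ.∣ seq x n ∣ ℚ.≤ B) → Eventually (λ n → ℚ.∣ seq y n ∣ ℚ.≤ C) →
            EventuallyClose (seq x) δ → EventuallyClose (seq y) δ →
            EventuallyClose (λ n → seq x n ℚ.* seq y n) ε
  combine B C δ 0<B 0<C [B+C]δ≡ε (K , xB) (L , yC) (M , p) (N , q) =
    (K ℕ.⊔ L) ℕ.⊔ (M ℕ.⊔ N) , λ m n lm ln →
      let KL≤m = ℕ.m⊔n≤o⇒m≤o (K ℕ.⊔ L) (M ℕ.⊔ N) lm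
          KL≤n = ℕ.m⊔n≤o⇒m≤o (K ℕ.⊔ L) (M ℕ.⊔ N) ln
          MN≤m = ℕ.m⊔n≤o⇒n≤o (K ℕ.⊔ L) (M ℕ.⊔ N) lm
          MN≤n = ℕ.m⊔n≤o⇒n≤o (K ℕ.⊔ L) (M ℕ.⊔ N) ln
      in ℚ.≤-trans
           (*-distance (seq x m) (seq x n) (seq y m) (seq y n) 0<B 0<C
             (xB m (ℕ.m⊔n≤o⇒m≤o K L KL≤m))
             (yC n (ℕ.m⊔n≤o⇒n≤o K L KL≤n))
             (p m n (ℕ.m⊔n≤o⇒m≤o M N MN≤m) (ℕ.m⊔n≤o⇒m≤o M N MN≤n))
             (q m n (ℕ.m⊔n≤o⇒n≤o M N MN≤m) (ℕ.m⊔n≤o⇒n≤o M N MN≤n)))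
           (ℚ.≤-reflexive [B+C]δ≡ε)

_*_ : ℝ → ℝ → ℝ
x * y = record { seq = λ n → seq x n ℚ.* seq y n ; cauchy = *-cauchy x y }

-‿congʳ : ∀ {x y} z → x ≃ y → x - z ≃ y - z
-‿congʳ {x} {y} z x≃y ε 0<ε =
  eventually₁
    (λ n h → +-halves (seq x n) (seq y n) (ℚ.- seq z n) (ℚ.- seq z n)
               h (∣p-p∣≤ (ℚ.- seq z n) (half-pos 0<ε)))
    (x≃y _ (half-pos 0<ε))

open VectorEquality ℝ-setoid public using (_≋_; ≋-setoid)

ℝ^_ : ℕ → Set
ℝ^ n = Vector ℝ n

infixl 6 _+ᵥ_ _-ᵥ_
infixr 7 _·ᵥ_

0ᵥ : ∀ {n} → ℝ^ n
0ᵥ = Vector.replicate _ 0ℝ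

_+ᵥ_ : ∀ {n} → ℝ^ n → ℝ^ n → ℝ^ n
_+ᵥ_ = Vector.zipWith _+_

_-ᵥ_ : ∀ {n} → ℝ^ n → ℝ^ n → ℝ^ n
_-ᵥ_ = Vector.zipWith _-_

_·ᵥ_ : ∀ {n} → ℝ → ℝ^ n → ℝ^ n
a ·ᵥ x = Vector.map (a *_) x

record Norm (n : ℕ) : Set where
  field
    ‖_‖         : ℝ^ n → ℝ
    cong-norm   : ∀ {x y} → x ≋ y → ‖ x ‖ ≃ ‖ y ‖
    nonNegative : ∀ x → 0ℝ ≤ ‖ x ‖
    definite    : ∀ x → ‖ x ‖ ≃ 0ℝ → x ≋ 0ᵥ
    homogeneous : ∀ a x → ‖ a ·ᵥ x ‖ ≃ ∣ a ∣ * ‖ x ‖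
    triangle    : ∀ x y → ‖ x +ᵥ y ‖ ≤ ‖ x ‖ + ‖ y ‖

record Region (n : ℕ) : Set₁ where
  field
    member : Pred (ℝ^ n) 0ℓ
    resp   : member Respects _≋_

open Region public

infix 4 _∈ᴿ_ _⊆ᴿ_

_∈ᴿ_ : ∀ {n} → ℝ^ n → Region n → Set
x ∈ᴿ A = member A x

_⊆ᴿ_ : ∀ {n} → Region n → Region n → Set
A ⊆ᴿ B = member A ⊆ member B

closedBall : ∀ {n} → Norm n → ℝ^ n → ℝ → Region n
closedBall N x₀ ε = record
  { member = λ x → ‖ x -ᵥ x₀ ‖ ≤ ε
  ; resp   = λ {x} {y} x≋y →
      ≤-respˡ-≃ {‖ x -ᵥ x₀ ‖} {‖ y -ᵥ x₀ ‖} {ε}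
        (cong-norm (λ i → -‿congʳ {x i} {y i} (x₀ i) (x≋y i)))
  }
  where open Norm N

-- No architecture is imposed: a network is any function ℝⁿ → ℝᵐ.
Network : ℕ → ℕ → Set
Network n m = Func (≋-setoid n) (≋-setoid m)

record Query (n m : ℕ) : Set₁ where
  field
    network : Network n m
    𝒳       : Region n
    𝒴       : Region m

open Query public

-- The first component says that both queries are over the same network,
-- as functions on ℝⁿ.
infix 4 _≼_

_≼_ : ∀ {n m} → Query n m → Query n m → Set
_≼_ {n} {m} q₂ q₁ =
  network q₂ ≈ network q₁ × 𝒳 q₂ ⊆ᴿ 𝒳 q₁ × 𝒴 q₂ ⊆ᴿ 𝒴 q₁
  where open FuncEquality (≋-setoid n) (≋-setoid m) using (_≈_)

OutputPredicate : ℕ → Set₁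
OutputPredicate n = ℝ^ n → ℝ^ n → Set

-- The region may depend on f, x₀ and P, but not on a norm or a radius.
record OutputRegion {n m} (f : Network n m) (x₀ : ℝ^ n) (P : OutputPredicate n) : Set₁ where
  field
    region     : Region m
    represents : ∀ x → P x₀ x ⇔ (f ⟨$⟩ x) ∈ᴿ region

robustnessQuery : ∀ {n m} (f : Network n m) (x₀ : ℝ^ n) → Norm n →
                  {P : OutputPredicate n} → OutputRegion f x₀ P → ℝ → Query n m
robustnessQuery f x₀ N Y ε = record
  { network = f
  ; 𝒳       = closedBall N x₀ ε
  ; 𝒴       = OutputRegion.region Y
  }

{-# OPTIONS --safe #-}
module Submission where

open import Defs
open import Data.Product using (_,_)
open import Data.Rational.Base as ℚ using (0ℚ; ½)
import Data.Rational.Properties as ℚ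
open import Function.Base using (id)
open import Function.Bundles using (_⟨$⟩_)
open import Relation.Binary.Bundles using (Setoid)
open import Relation.Binary.PropositionalEquality using (cong)

open ℚ.≤-Reasoning

-- Both queries share `f` and the region of `Y`, so only the input regions differ, and a closed ball
-- grows with its radius: a distance at most `εⱼ` is at most `εᵢ`. On Cauchy reals this rests on
-- `<⇒≤` and `≤-trans`.

<⇒≤ : ∀ {x y} → x < y → x ≤ y
<⇒≤ {x} {y} (δ , 0<δ , x+δ≤y) ε 0<ε = eventually₁ step x+δ≤y
  where
  step : ∀ n → seq x n ℚ.+ δ ℚ.≤ seq y n → seq x n ℚ.≤ seq y n ℚ.+ ε
  -- The gap `δ` of `<` and the slack `ε` of `≤` are both positive, so dropping one and adding the
  -- other only weakens `h`; the index bound is unchanged.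
  step n h = begin
    seq x n          ≡⟨ ℚ.+-identityʳ (seq x n) ⟨
    seq x n ℚ.+ 0ℚ   ≤⟨ ℚ.+-monoʳ-≤ (seq x n) (ℚ.<⇒≤ 0<δ) ⟩
    seq x n ℚ.+ δ    ≤⟨ h ⟩
    seq y n          ≡⟨ ℚ.+-identityʳ (seq y n) ⟨
    seq y n ℚ.+ 0ℚ   ≤⟨ ℚ.+-monoʳ-≤ (seq y n) (ℚ.<⇒≤ 0<ε) ⟩
    seq y n ℚ.+ ε    ∎

-- Since `≤` holds termwise only up to an error, the two errors add up; each hypothesis is therefore
-- used at half of `ε`.
≤-trans : ∀ {x y z} → x ≤ y → y ≤ z → x ≤ z
≤-trans {x} {y} {z} x≤y y≤z ε 0<ε =
  eventually₂ step (x≤y δ (half-pos 0<ε)) (y≤z δ (half-pos 0<ε))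
  where
  δ = ½ ℚ.* ε
  step : ∀ n → seq x n ℚ.≤ seq y n ℚ.+ δ → seq y n ℚ.≤ seq z n ℚ.+ δ →
         seq x n ℚ.≤ seq z n ℚ.+ ε
  step n h k = begin
    seq x n                  ≤⟨ h ⟩
    seq y n ℚ.+ δ            ≤⟨ ℚ.+-monoˡ-≤ δ k ⟩
    (seq z n ℚ.+ δ) ℚ.+ δ    ≡⟨ ℚ.+-assoc (seq z n) δ δ ⟩
    seq z n ℚ.+ (δ ℚ.+ δ)    ≡⟨ cong (seq z n ℚ.+_) (half+half ε) ⟩
    seq z n ℚ.+ ε            ∎

closedBall-mono : ∀ {n} (N : Norm n) (x₀ : ℝ^ n) {δ ε} → δ ≤ ε →
                  closedBall N x₀ δ ⊆ᴿ closedBall N x₀ ε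
closedBall-mono N x₀ {δ} {ε} δ≤ε {x} x∈B =
  -- `≤` unfolds to a statement about `seq` alone, which does not determine the `cauchy` field, so
  -- the reals are passed explicitly.
  ≤-trans {Norm.‖_‖ N (x -ᵥ x₀)} {δ} {ε} x∈B δ≤ε

proposition1 : ∀ {n m} (f : Network n m) (x₀ : ℝ^ n) (‖·‖ : Norm n)
    (P : OutputPredicate n) (Y : OutputRegion f x₀ P)
    (εᵢ εⱼ : ℝ) → 0ℝ ≤ εᵢ → 0ℝ ≤ εⱼ → εᵢ > εⱼ →
    robustnessQuery f x₀ ‖·‖ Y εⱼ ≼ robustnessQuery f x₀ ‖·‖ Y εᵢ
proposition1 {m = m} f x₀ ‖·‖ P Y εᵢ εⱼ _ _ εⱼ<εᵢ =
  (λ x → Setoid.refl (≋-setoid m) {f ⟨$⟩ x}) ,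
  (λ {x} → closedBall-mono ‖·‖ x₀ {εⱼ} {εᵢ} (<⇒≤ {εⱼ} {εᵢ} εⱼ<εᵢ) {x}) ,
  -- The output region is built into `Y` and does not vary with the radius.
  id
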